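{- (a i) Let $(X,d)$ be a metric space admitting a polynomially standard representation $\xi:\subseteq\mathcal C\twoheadrightarrow X$, and let $\xi':\subseteq\mathcal C\twoheadrightarrow X$ be a polynomially admissible representation. Then $\xi'$ is polynomially standard. (a ii) Let $(X,d)$ be a metric space admitting a linearly standard representation $\xi:\subseteq\mathcal C\twoheadrightarrow X$, and let $\xi':\subseteq\mathcal C\twoheadrightarrow X$ be a linearly admissible representation. Then $\xi'$ is linearly standard. (b) Let $(X,d)$ be a metric space with entropy $\eta$, let $(Y,e)$ be a metric space, $\xi:\subseteq\mathcal C\twoheadrightarrow X$ a representation, $f:X\to Y$, and let $\lambda:\mathbb N\to\mathbb N$ be non-decreasing such that $f\circ\xi$ has modulus of continuity $\eta\circ\lambda$. (b i) If $\xi$ is polynomially standard, then there is $c\in\mathbb N$ such that $f$ has modulus of continuity $n\mapsto c+c\cdot\lambda(n)^c$. (b ii) If $\xi$ is linearly standard, then there is $c\in\mathbb N$ such that $f$ has modulus of continuity $n\mapsto c+c\cdot\lambda(n)$. In (c) and (d), let $(X,d)$ and $(Y,e)$ be metric spaces with entropies $\eta$ and $\theta$, respectively, with representations $\xi:\subseteq\mathcal C\twoheadrightarrow X$ and $\upsilon:\subseteq\mathcal C\twoheadrightarrow Y$, and let $\lambda:\mathbb N\to\mathbb N$ be non-decreasing. (c i) Suppose $\xi,\upsilon$ are polynomially standard and $f:X\to Y$ has modulus of continuity $\lambda$. Then $f$ admits a $(\xi,\upsilon)$-realizer $F:\mathrm{dom}(\xi)\to\mathrm{dom}(\upsilon)$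 with a modulus of continuity $\Lambda$ for which there are polynomials $p,q$ with natural-number coefficients such that $\Lambda(\theta(n))\le\eta\big(p(\lambda(q(n)))\big)$ for all $n\in\mathbb N$. (c ii) Suppose $\xi,\upsilon$ are linearly standard and $f:X\to Y$ has modulus of continuity $\lambda$. Then $f$ admits a $(\xi,\upsilon)$-realizer $F$ with a modulus of continuity $\Lambda$ for which there is $c\in\mathbb N$ such that $\Lambda(\theta(n))\le\eta\big(c+c\cdot\lambda(c+c\cdot n)\big)$ for all $n\in\mathbb N$. (d i) Suppose $\xi,\upsilon$ are polynomially standard and $f:X\to Y$ admits a $(\xi,\upsilon)$-realizer $F$ with modulus of continuity $\eta\circ\lambda$. Then there are polynomials $p,q$ with natural-number coefficients such that $f$ has modulus of continuity $p\circ\lambda\circ\theta\circ q$. (d ii) Suppose $\xi,\upsilon$ are linearly standard and $f:X\to Y$ admits a $(\xi,\upsilon)$-realizer $F$ with modulus of continuity $\eta\circ\lambda$. Then there is $c\in\mathbb N$ such that $f$ has modulus of continuity $n\mapsto c+c\cdot\lambda\big(\theta(c+c\cdot n)\big)$.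
   Context: $\mathbb N=\{0,1,2,\dots\}$. Cantor space $\mathcal C=\{0,1\}^{\mathbb N}$ carries the metric $D(\bar u,\bar v)=2^{ -\min\{n:u_n\neq v_n\}}$ for $\bar u\ne\bar v$, and $D(\bar u,\bar u)=0$. Modulus: a modulus of continuity of $f:(X,d)\to(Y,e)$ is a non-decreasing $\mu:\mathbb N\to\mathbb N$ such that for all $n$ and all $x,x'$: $d(x,x')\le2^{ -\mu(n)}$ implies $e(f(x),f(x'))\le2^{ -n}$. For a partial map, $x,x'$ range over its domain (a metric subspace). The minimal modulus is the pointwise least one. Entropy: the (binary) entropy of $X$ is $\eta(n)=\lceil\log_2\hat\eta(n)\rceil$, where $\hat\eta(n)$ is the least number of closed balls of radius $2^{ -n}$ with centers in $X$ that cover $X$. Representation: a surjective partial map $\xi:\subseteq\mathcal C\twoheadrightarrow X$. Given representations $\xi$ of $X$ and $\upsilon$ of $Y$, a $(\xi,\upsilon)$-realizer of $f:X\to Y$ is a map $F:\mathrm{dom}(\xi)\to\mathrm{dom}(\upsilon)$ with $f(\xi(u))=\upsilon(F(u))$ for all $u\in\mathrm{dom}(\xi)$. The induced semi-metric is $d_\xi(x,x')=\min\{D(u,u'):\xi(u)=x,\ \xi(u')=x'\}$. Reductions: let $\xi,\xi':\subseteq\mathcal C\to X$ be partial maps (not necessarily surjective) with minimal moduli of continuity $\mu,\mu'$. A polynomial (resp. linear) reduction from $\xi'$ to $\xi$ is a map $G:\mathrm{dom}(\xi')\to\mathrm{dom}(\xi)$ with a modulus of continuity $\nu$ such that $\xi'(u)=\xi(G(u))$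 for all $u\in\mathrm{dom}(\xi')$ and, for some $c\in\mathbb N$ and all $n$, $\nu(\mu(n))\le\mu'(c+c\,n^c)$ (resp. $\nu(\mu(n))\le\mu'(c+c\,n)$). Let $(X,d)$ have entropy $\eta$ and let $\xi:\subseteq\mathcal C\twoheadrightarrow X$ be a representation with minimal modulus of continuity $\mu$. - $\xi$ is polynomially admissible if: (1) for some $c$ and all $n$, $\mu(n)\le\eta(c+c\,n^c)$; and (2) every surjective partial $\xi':\subseteq\mathcal C\twoheadrightarrow X$ possessing a modulus of continuity has a polynomial reduction to $\xi$. - $\xi$ is polynomially standard if (1) holds; (2') every (not necessarily surjective) partial $\xi':\subseteq\mathcal C\to X$ possessing a modulus of continuity has a polynomial reduction to $\xi$; and (3) there is a polynomial $p$ with natural-number coefficients such that for all $n$ and $x,x'\in X$, $d(x,x')\le2^{ -p(n)}$ implies $d_\xi(x,x')\le2^{ -\eta(n)}$. - $\xi$ is linearly admissible / linearly standard if the same conditions hold with $c+c\,n$ in place of $c+c\,n^c$, with linear in place of polynomial reductions, and with $p(n)$ of the form $c+c\,n$. -}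

module Defs where

open import Level using (Level; 0ℓ; suc; _⊔_)
open import Data.Bool using (Bool)
import Data.Bool.Properties as Bool
open import Data.Fin using (Fin)
open import Data.List using (List; foldr)
open import Data.Nat as ℕ using (ℕ; zero; _≤_)
import Data.Nat.Properties as ℕ
open import Data.Nat.Logarithm using (⌈log₂_⌉)
open import Data.Product using (Σ; Σ-syntax; ∃; ∃-syntax; ∃₂; _×_; _,_; proj₁; proj₂)
open import Data.Rational as ℚ using (ℚ; 0ℚ; 1ℚ; ½)
import Data.Rational.Properties as ℚ
open import Data.Sum using (_⊎_; inj₁; inj₂)
open import Function using (Func; _on_)
import Function.Construct.Composition as Composition
open import Function.Definitions using (StrictlySurjective)
open import Function.Metric.Structures using (IsGeneralMetric)
open import Relation.Binary
  using (Rel; Setoid; Monotonic₁; _Respects_; IsEquivalence; IsPartialOrder; tri<; tri≈; tri>)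
open import Relation.Binary.PropositionalEquality
  using (_≡_; _≢_; _≗_; refl; sym; trans; cong; subst; module ≡-Reasoning)
open import Relation.Nullary using (¬_; yes; no; contradiction)
open import Relation.Unary using (Pred; _∈_; _∉_; _⊆_)

private
  variable
    a b c ℓ ℓ₁ ℓ₂ ℓ₃ : Level

-- A real number is a Dedekind cut, given by its open lower half.  The upper
-- half is determined by the lower one under excluded middle.

record ℝ : Set₁ where
  field
    L          : Pred ℚ 0ℓ
    inhabited  : ∃[ q ] q ∈ L
    bounded    : ∃[ q ] q ∉ L
    downClosed : ∀ {p q} → p ℚ.< q → q ∈ L → p ∈ L
    rounded    : ∀ {p} → p ∈ L → ∃[ q ] (p ℚ.< q × q ∈ L)

open ℝ

infix 4 _≤ᴿ_ _≃ᴿ_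

record _≤ᴿ_ (x y : ℝ) : Set where
  constructor L⊆
  field
    L-⊆ : L x ⊆ L y

open _≤ᴿ_ public

_≃ᴿ_ : Rel ℝ 0ℓ
x ≃ᴿ y = x ≤ᴿ y × y ≤ᴿ x

≤ᴿ-trans : ∀ {x y z} → x ≤ᴿ y → y ≤ᴿ z → x ≤ᴿ z
≤ᴿ-trans (L⊆ f) (L⊆ g) = L⊆ (λ q∈x → g (f q∈x))

≤ᴿ-refl : ∀ {x} → x ≤ᴿ x
≤ᴿ-refl = L⊆ (λ q∈x → q∈x)

≃ᴿ-isEquivalence : IsEquivalence _≃ᴿ_
≃ᴿ-isEquivalence = record
  { refl  = ≤ᴿ-refl , ≤ᴿ-refl
  ; sym   = λ (p , q) → q , p
  ; trans = λ (p , q) (r , s) → ≤ᴿ-trans p r , ≤ᴿ-trans s q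
  }

≤ᴿ-isPartialOrder : IsPartialOrder _≃ᴿ_ _≤ᴿ_
≤ᴿ-isPartialOrder = record
  { isPreorder = record
    { isEquivalence = ≃ᴿ-isEquivalence
    ; reflexive     = proj₁
    ; trans         = ≤ᴿ-trans
    }
  ; antisym = _,_
  }

fromℚ : ℚ → ℝ
fromℚ r = record
  { L          = ℚ._< r
  ; inhabited  = r ℚ.- 1ℚ , subst (r ℚ.- 1ℚ ℚ.<_) (ℚ.+-identityʳ r)
                               (ℚ.+-monoʳ-< r (ℚ.negative⁻¹ (ℚ.- 1ℚ)))
  ; bounded    = r , ℚ.<-irrefl refl
  ; downClosed = ℚ.<-trans
  ; rounded    = ℚ.<-dense
  }

0ᴿ : ℝ
0ᴿ = fromℚ 0ℚ

∈∉⇒< : ∀ x {p q} → p ∈ L x → q ∉ L x → p ℚ.< q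
∈∉⇒< x {p} {q} p∈ q∉ with ℚ.<-cmp p q
... | tri< p<q _ _    = p<q
... | tri≈ _ refl _   = contradiction p∈ q∉
... | tri> _ _ q<p    = contradiction (downClosed x q<p p∈) q∉

private
  shift : ∀ p r s → (r ℚ.+ s) ℚ.+ (p ℚ.- (r ℚ.+ s)) ≡ p
  shift p r s = begin
    (r ℚ.+ s) ℚ.+ (p ℚ.- (r ℚ.+ s))     ≡⟨ cong ((r ℚ.+ s) ℚ.+_) (ℚ.+-comm p _) ⟩
    (r ℚ.+ s) ℚ.+ (ℚ.- (r ℚ.+ s) ℚ.+ p) ≡⟨ ℚ.+-assoc (r ℚ.+ s) _ p ⟨
    ((r ℚ.+ s) ℚ.- (r ℚ.+ s)) ℚ.+ p     ≡⟨ cong (ℚ._+ p) (ℚ.+-inverseʳ (r ℚ.+ s)) ⟩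
    0ℚ ℚ.+ p                            ≡⟨ ℚ.+-identityˡ p ⟩
    p                                   ∎
    where open ≡-Reasoning

  <⇒-<0 : ∀ {p q} → p ℚ.< q → p ℚ.- q ℚ.< 0ℚ
  <⇒-<0 {p} {q} p<q = subst (p ℚ.- q ℚ.<_) (ℚ.+-inverseʳ q) (ℚ.+-monoˡ-< (ℚ.- q) p<q)

infixl 6 _+ᴿ_

_+ᴿ_ : ℝ → ℝ → ℝ
x +ᴿ y = record
  { L          = λ q → ∃₂ λ r s → r ∈ L x × s ∈ L y × q ≡ r ℚ.+ s
  ; inhabited  = let (r , r∈) = inhabited x ; (s , s∈) = inhabited y in
                 r ℚ.+ s , r , s , r∈ , s∈ , refl
  ; bounded    = let (r , r∉) = bounded x ; (s , s∉) = bounded y in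
                 r ℚ.+ s , λ (r′ , s′ , r′∈ , s′∈ , eq) →
                   ℚ.<-irrefl (sym eq) (ℚ.+-mono-< (∈∉⇒< x r′∈ r∉) (∈∉⇒< y s′∈ s∉))
  ; downClosed = λ { {p} p<q (r , s , r∈ , s∈ , refl) →
                   r , s ℚ.+ (p ℚ.- (r ℚ.+ s)) , r∈
                   , downClosed y
                       (subst (s ℚ.+ (p ℚ.- (r ℚ.+ s)) ℚ.<_) (ℚ.+-identityʳ s)
                         (ℚ.+-monoʳ-< s (<⇒-<0 p<q))) s∈
                   , trans (sym (shift p r s)) (ℚ.+-assoc r s _) }
  ; rounded    = λ { (r , s , r∈ , s∈ , refl) →
                   let (r′ , r<r′ , r′∈) = rounded x r∈ in
                   r′ ℚ.+ s , ℚ.+-monoˡ-< s r<r′ , r′ , s , r′∈ , s∈ , refl }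
  }

½^_ : ℕ → ℚ
½^ zero      = 1ℚ
½^ (ℕ.suc n) = ½ ℚ.* ½^ n

2^-_ : ℕ → ℝ
2^- n = fromℚ (½^ n)

IsMinimum : Pred ℝ ℓ → ℝ → Set (suc 0ℓ ⊔ ℓ)
IsMinimum S r = r ∈ S × (∀ {s} → s ∈ S → r ≤ᴿ s)

record MetricSpace a ℓ : Set (suc (a ⊔ ℓ)) where
  infix 4 _≈_
  field
    Carrier  : Set a
    _≈_      : Rel Carrier ℓ
    d        : Carrier → Carrier → ℝ
    isMetric : IsGeneralMetric _≈_ _≃ᴿ_ _≤ᴿ_ 0ᴿ _+ᴿ_ d

  open IsGeneralMetric isMetric public

  setoid : Setoid a ℓ
  setoid = record { isEquivalence = ≈-isEquivalence }

record Map (X : MetricSpace a ℓ₁) (Y : MetricSpace b ℓ₂) : Set (a ⊔ b ⊔ ℓ₁ ⊔ ℓ₂) where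
  field
    func : Func (MetricSpace.setoid X) (MetricSpace.setoid Y)

  open Func func public using (to) renaming (cong to to-cong)

infixr 9 _∘ᴹ_

_∘ᴹ_ : {X : MetricSpace a ℓ₁} {Y : MetricSpace b ℓ₂} {Z : MetricSpace c ℓ₃} →
       Map Y Z → Map X Y → Map X Z
g ∘ᴹ f = record { func = Composition.function (Map.func f) (Map.func g) }

subspace : (X : MetricSpace a ℓ₁) → Pred (MetricSpace.Carrier X) ℓ₂ → MetricSpace (a ⊔ ℓ₂) ℓ₁
subspace X P = record
  { Carrier  = ∃ P
  ; _≈_      = _≈_ on proj₁
  ; d        = d on proj₁
  ; isMetric = record
    { isSemiMetric = record
      { isQuasiSemiMetric = record
        { isPreMetric = record
          { isProtoMetric = record
            { isPartialOrder  = isPartialOrder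
            ; ≈-isEquivalence = record { refl = EqC.refl ; sym = EqC.sym ; trans = EqC.trans }
            ; cong            = cong′
            ; nonNegative     = nonNegative
            }
          ; ≈⇒0 = ≈⇒0
          }
        ; 0⇒≈ = 0⇒≈
        }
      ; sym = λ x y → sym′ (proj₁ x) (proj₁ y)
      }
    ; triangle = λ x y z → triangle (proj₁ x) (proj₁ y) (proj₁ z)
    }
  }
  where open MetricSpace X renaming (cong to cong′; sym to sym′)

record HasModulus {X : MetricSpace a ℓ₁} {Y : MetricSpace b ℓ₂}
                  (f : Map X Y) (μ : ℕ → ℕ) : Set a where
  open MetricSpace X using (d)
  open MetricSpace Y using () renaming (d to e)
  open Map f using (to)
  field
    nonDecreasing : Monotonic₁ _≤_ _≤_ μ
    modulus       : ∀ n x x′ → d x x′ ≤ᴿ 2^- μ n → e (to x) (to x′) ≤ᴿ 2^- n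

IsMinimalModulus : {X : MetricSpace a ℓ₁} {Y : MetricSpace b ℓ₂} → Map X Y → (ℕ → ℕ) → Set a
IsMinimalModulus f μ = HasModulus f μ × (∀ ν → HasModulus f ν → ∀ n → μ n ≤ ν n)

module _ (X : MetricSpace a ℓ) where
  open MetricSpace X

  CoveredBy : ℕ → ℕ → Set a
  CoveredBy n N = Σ[ centre ∈ (Fin N → Carrier) ] (∀ x → ∃[ i ] d (centre i) x ≤ᴿ 2^- n)

  IsLeastCoverSize : ℕ → ℕ → Set a
  IsLeastCoverSize n N = CoveredBy n N × (∀ M → CoveredBy n M → N ≤ M)

  -- For the empty space the least cover has size 0, and ⌈log₂ 0 ⌉ = 0.
  IsEntropy : (ℕ → ℕ) → Set a
  IsEntropy η = ∀ n → ∃[ N ] (IsLeastCoverSize n N × η n ≡ ⌈log₂ N ⌉)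

𝒞 : Set
𝒞 = ℕ → Bool

FirstDifference : 𝒞 → 𝒞 → ℕ → Set
FirstDifference u v n = u n ≢ v n × (∀ k → k ℕ.< n → u k ≡ v k)

private
  ½^-pos : ∀ n → 0ℚ ℚ.< ½^ n
  ½^-pos zero      = ℚ.positive⁻¹ 1ℚ
  ½^-pos (ℕ.suc n) = ℚ.*-monoʳ-<-pos ½ (½^-pos n)

  ½*≤ : ∀ p → 0ℚ ℚ.< p → ½ ℚ.* p ℚ.≤ p
  ½*≤ p 0<p = subst (½ ℚ.* p ℚ.≤_) (ℚ.*-identityˡ p)
    (ℚ.*-monoʳ-≤-nonNeg p {{ℚ.nonNegative (ℚ.<⇒≤ 0<p)}} (ℚ.≤ᵇ⇒≤ {½} {1ℚ} _))

  ½^-anti : ∀ {m n} → m ℕ.≤′ n → ½^ n ℚ.≤ ½^ m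
  ½^-anti ℕ.≤′-refl             = ℚ.≤-refl
  ½^-anti (ℕ.≤′-step {n} m≤n) = ℚ.≤-trans (½*≤ (½^ n) (½^-pos n)) (½^-anti m≤n)

-- The cut of 2^-min{n : u n ≢ v n}, which is that of 0 if u ≗ v.
D : 𝒞 → 𝒞 → ℝ
D u v = record
  { L          = λ q → q ℚ.< 0ℚ ⊎ ∃[ n ] (FirstDifference u v n × q ℚ.< ½^ n)
  ; inhabited  = ℚ.- 1ℚ , inj₁ (ℚ.negative⁻¹ (ℚ.- 1ℚ))
  ; bounded    = 1ℚ , λ where
      (inj₁ 1<0)           → ℚ.<-asym 1<0 (ℚ.positive⁻¹ 1ℚ)
      (inj₂ (n , _ , 1<½)) → ℚ.<-irrefl refl (ℚ.<-≤-trans 1<½ (½^-anti {0} {n} (ℕ.≤⇒≤′ ℕ.z≤n)))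
  ; downClosed = λ where
      p<q (inj₁ q<0)           → inj₁ (ℚ.<-trans p<q q<0)
      p<q (inj₂ (n , δ , q<½)) → inj₂ (n , δ , ℚ.<-trans p<q q<½)
  ; rounded    = λ where
      (inj₁ q<0)           → let (r , q<r , r<0) = ℚ.<-dense q<0 in r , q<r , inj₁ r<0
      (inj₂ (n , δ , q<½)) → let (r , q<r , r<½) = ℚ.<-dense q<½ in r , q<r , inj₂ (n , δ , r<½)
  }

private
  search : ∀ u v n → (∃[ m ] (m ℕ.< n × FirstDifference u v m)) ⊎ (∀ k → k ℕ.< n → u k ≡ v k)
  search u v zero = inj₂ λ _ ()
  search u v (ℕ.suc n) with search u v n
  ... | inj₁ (m , m<n , δ) = inj₁ (m , ℕ.m<n⇒m<1+n m<n , δ)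
  ... | inj₂ agree with u n Bool.≟ v n
  ...   | no un≢vn = inj₁ (n , ℕ.n<1+n n , un≢vn , agree)
  ...   | yes un≡vn = inj₂ λ k k<1+n → extend k (ℕ.m<1+n⇒m<n∨m≡n k<1+n)
    where
    extend : ∀ k → k ℕ.< n ⊎ k ≡ n → u k ≡ v k
    extend k (inj₁ k<n)  = agree k k<n
    extend k (inj₂ refl) = un≡vn

  firstDifference : ∀ u v n → u n ≢ v n → ∃[ m ] (m ≤ n × FirstDifference u v m)
  firstDifference u v n un≢vn with search u v (ℕ.suc n)
  ... | inj₁ (m , m<1+n , δ) = m , ℕ.≤-pred m<1+n , δ
  ... | inj₂ agree           = contradiction (agree n (ℕ.n<1+n n)) un≢vn

  D-cong : ∀ {u u′ v v′} → u ≗ u′ → v ≗ v′ → D u v ≤ᴿ D u′ v′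
  D-cong u≗ v≗ = L⊆ λ where
    (inj₁ q<0) → inj₁ q<0
    (inj₂ (n , (un≢vn , agree) , q<½)) → inj₂ (n
      , ( (λ eq → un≢vn (trans (u≗ n) (trans eq (sym (v≗ n)))))
        , (λ k k<n → trans (sym (u≗ k)) (trans (agree k k<n) (v≗ k))))
      , q<½)

  D-sym : ∀ u v → D u v ≤ᴿ D v u
  D-sym u v = L⊆ λ where
    (inj₁ q<0) → inj₁ q<0
    (inj₂ (n , (un≢vn , agree) , q<½)) → inj₂ (n
      , ((λ eq → un≢vn (sym eq)) , (λ k k<n → sym (agree k k<n))) , q<½)

  D-zero : ∀ {u v} → u ≗ v → D u v ≤ᴿ 0ᴿ
  D-zero u≗v = L⊆ λ where
    (inj₁ q<0)                       → q<0
    (inj₂ (n , (un≢vn , _) , _)) → contradiction (u≗v n) un≢vn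

  D-zero⁻¹ : ∀ {u v} → D u v ≤ᴿ 0ᴿ → u ≗ v
  D-zero⁻¹ {u} {v} D≤0 n with u n Bool.≟ v n
  ... | yes un≡vn = un≡vn
  ... | no un≢vn with firstDifference u v n un≢vn
  ...   | m , _ , δ = contradiction (L-⊆ D≤0 (inj₂ (m , δ , ½^-pos m))) (ℚ.<-irrefl refl)

  split : ∀ {q r} → q ℚ.< r → ∃₂ λ s t → s ℚ.< r × t ℚ.< 0ℚ × q ≡ s ℚ.+ t
  split {q} {r} q<r with ℚ.<-dense q<r
  ... | s , q<s , s<r = s , q ℚ.- s , s<r , <⇒-<0 q<s , sym (begin
    s ℚ.+ (q ℚ.- s)       ≡⟨ cong (s ℚ.+_) (ℚ.+-comm q (ℚ.- s)) ⟩
    s ℚ.+ (ℚ.- s ℚ.+ q)   ≡⟨ ℚ.+-assoc s (ℚ.- s) q ⟨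
    (s ℚ.- s) ℚ.+ q       ≡⟨ cong (ℚ._+ q) (ℚ.+-inverseʳ s) ⟩
    0ℚ ℚ.+ q              ≡⟨ ℚ.+-identityˡ q ⟩
    q                     ∎)
    where open ≡-Reasoning

  D-triangle : ∀ u v w → D u w ≤ᴿ D u v +ᴿ D v w
  D-triangle u v w = L⊆ (go _)
    where
    go : ∀ q → q ∈ L (D u w) → q ∈ L (D u v +ᴿ D v w)
    go q (inj₁ q<0) with split q<0
    ... | s , t , s<0 , t<0 , eq = s , t , inj₁ s<0 , inj₁ t<0 , eq
    go q (inj₂ (n , (un≢wn , _) , q<½)) with split q<½ | u n Bool.≟ v n
    ... | s , t , s<½ , t<0 , eq | no un≢vn =
      let (m , m≤n , δ) = firstDifference u v n un≢vn in
      s , t , inj₂ (m , δ , ℚ.<-≤-trans s<½ (½^-anti (ℕ.≤⇒≤′ m≤n))) , inj₁ t<0 , eq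
    ... | s , t , s<½ , t<0 , eq | yes un≡vn =
      let (m , m≤n , δ) = firstDifference v w n (λ vn≡wn → un≢wn (trans un≡vn vn≡wn)) in
      t , s , inj₁ t<0 , inj₂ (m , δ , ℚ.<-≤-trans s<½ (½^-anti (ℕ.≤⇒≤′ m≤n)))
      , trans eq (ℚ.+-comm s t)

cantor : MetricSpace 0ℓ 0ℓ
cantor = record
  { Carrier  = 𝒞
  ; _≈_      = _≗_
  ; d        = D
  ; isMetric = record
    { isSemiMetric = record
      { isQuasiSemiMetric = record
        { isPreMetric = record
          { isProtoMetric = record
            { isPartialOrder  = ≤ᴿ-isPartialOrder
            ; ≈-isEquivalence = record
              { refl  = λ _ → refl
              ; sym   = λ u≗v n → sym (u≗v n)
              ; trans = λ u≗v v≗w n → trans (u≗v n) (v≗w n)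
              }
            ; cong            = λ u≗ v≗ → D-cong u≗ v≗ , D-cong (λ n → sym (u≗ n)) (λ n → sym (v≗ n))
            ; nonNegative     = L⊆ inj₁
            }
          ; ≈⇒0 = λ u≗v → D-zero u≗v , L⊆ inj₁
          }
        ; 0⇒≈ = λ D≃0 → D-zero⁻¹ (proj₁ D≃0)
        }
      ; sym = λ u v → D-sym u v , D-sym v u
      }
    ; triangle = D-triangle
    }
  }

record PartialMap (X : MetricSpace a ℓ) : Set (suc 0ℓ ⊔ a ⊔ ℓ) where
  field
    -- Under excluded middle, small predicates give all subsets of 𝒞.
    dom      : Pred 𝒞 0ℓ
    dom-resp : dom Respects _≗_

  domain : MetricSpace 0ℓ 0ℓ
  domain = subspace cantor dom

  field
    map : Map domain X

  open Map map public using () renaming (to to ⟦_⟧)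

record Representation (X : MetricSpace a ℓ) : Set (suc 0ℓ ⊔ a ⊔ ℓ) where
  open MetricSpace X using (_≈_)
  field
    partialMap : PartialMap X

  open PartialMap partialMap public

  field
    surjective : StrictlySurjective _≈_ ⟦_⟧

open PartialMap using (domain; map; ⟦_⟧)
open Representation using (partialMap)

IsRealizer : {X : MetricSpace a ℓ₁} {Y : MetricSpace b ℓ₂} →
             (ξ : PartialMap X) (υ : PartialMap Y) (f : Map X Y) →
             Map (domain ξ) (domain υ) → Set ℓ₂
IsRealizer {Y = Y} ξ υ f F = ∀ u → Map.to f (⟦ ξ ⟧ u) ≈ ⟦ υ ⟧ (Map.to F u)
  where open MetricSpace Y

-- d_ξ(x,x′) as a relation; the predicate holds of at most one real up to _≃ᴿ_.
IsInducedDistance : {X : MetricSpace a ℓ} (ξ : PartialMap X) →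
                    (x x′ : MetricSpace.Carrier X) → ℝ → Set (suc 0ℓ ⊔ ℓ)
IsInducedDistance {X = X} ξ x x′ = IsMinimum λ r →
  ∃₂ λ u u′ → ⟦ ξ ⟧ u ≈ x × ⟦ ξ ⟧ u′ ≈ x′ × MetricSpace.d (domain ξ) u u′ ≃ᴿ r
  where open MetricSpace X

data Growth : Set where
  polynomial linear : Growth

bound : Growth → ℕ → ℕ → ℕ
bound polynomial c n = c ℕ.+ c ℕ.* n ℕ.^ c
bound linear     c n = c ℕ.+ c ℕ.* n

-- Coefficients in order of increasing degree.
Polynomial : Set
Polynomial = List ℕ

eval : Polynomial → ℕ → ℕ
eval p n = foldr (λ coeff rest → coeff ℕ.+ n ℕ.* rest) 0 p

HasGrowth : Growth → (ℕ → ℕ) → Set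
HasGrowth polynomial g = ∃[ p ] g ≗ eval p
HasGrowth linear     g = ∃[ c ] g ≗ bound linear c

-- A reduction from ξ′ to ξ.
record Reduction (γ : Growth) {X : MetricSpace a ℓ} (ξ′ ξ : PartialMap X) : Set (a ⊔ ℓ) where
  open MetricSpace X using (_≈_)
  field
    μ μ′       : ℕ → ℕ
    μ-minimal  : IsMinimalModulus (map ξ) μ
    μ′-minimal : IsMinimalModulus (map ξ′) μ′
    G          : Map (domain ξ′) (domain ξ)
    ν          : ℕ → ℕ
    G-modulus  : HasModulus G ν
    commutes   : ∀ u → ⟦ ξ′ ⟧ u ≈ ⟦ ξ ⟧ (Map.to G u)
    efficient  : ∃[ c ] (∀ n → ν (μ n) ≤ μ′ (bound γ c n))

-- In the two records below η stands for the entropy of X; that it is the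
-- entropy is left to the context in which they are used.

record IsAdmissible (γ : Growth) (X : MetricSpace a ℓ) (η : ℕ → ℕ)
                    (ξ : Representation X) : Set (suc 0ℓ ⊔ a ⊔ ℓ) where
  field
    μ         : ℕ → ℕ
    μ-minimal : IsMinimalModulus (map (partialMap ξ)) μ
    optimal   : ∃[ c ] (∀ n → μ n ≤ η (bound γ c n))
    universal : (ξ′ : Representation X) → ∃ (HasModulus (map (partialMap ξ′))) →
                Reduction γ (partialMap ξ′) (partialMap ξ)

record IsStandard (γ : Growth) (X : MetricSpace a ℓ) (η : ℕ → ℕ)
                  (ξ : Representation X) : Set (suc 0ℓ ⊔ a ⊔ ℓ) where
  open MetricSpace X using (d)
  field
    μ         : ℕ → ℕ
    μ-minimal : IsMinimalModulus (map (partialMap ξ)) μ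
    optimal   : ∃[ c ] (∀ n → μ n ≤ η (bound γ c n))
    universal : (ξ′ : PartialMap X) → ∃ (HasModulus (map ξ′)) →
                Reduction γ ξ′ (partialMap ξ)
    coherent  : ∃[ p ] (HasGrowth γ p × (∀ n x x′ → d x x′ ≤ᴿ 2^- p n →
                  ∃[ r ] (IsInducedDistance (partialMap ξ) x x′ r × r ≤ᴿ 2^- η n)))

{-# OPTIONS --safe #-}

-- Everything rests on two facts.  First, if a representation has modulus μ,
-- the 2^μ(n) prefixes of length μ(n) cover the space by balls of radius 2^-n,
-- so η ≤ μ.  Secondly, coherence of a standard representation turns points at
-- distance 2^-p(n) into names at distance 2^-η(n), and so turns a modulus of
-- f ∘ ξ into one of f.  Realizers come from universality applied to f ∘ ξ.
-- For (a), a reduction from ξ to ξ′ carries close names for ξ to close names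
-- for ξ′; the minimum defining the induced distance of ξ′ is attained because
-- distances in 𝒞 are powers of two and a modulus keeps names of distinct points
-- apart.

module Submission where

open import Defs
open import Level using (Level; 0ℓ)
open import Axiom.ExcludedMiddle using (ExcludedMiddle)
open import Data.Fin using (Fin; toℕ; fromℕ<; funToFin; finToFun)
import Data.Fin.Properties as Fin
import Data.Integer as ℤ
import Data.Integer.Properties as ℤ
open import Data.List using ([]; _∷_; _++_; replicate)
open import Data.Nat
  using (ℕ; zero; suc; _+_; _*_; _^_; _≤_; _<_; z≤n; s≤s; _≤′_; ≤′-refl; ≤′-step; _⊔_)
open import Data.Nat.Logarithm using (⌈log₂⌉-mono-≤; ⌈log₂2^n⌉≡n)
open import Data.Nat.Properties
open import Data.Product using (∃; ∃₂; ∃-syntax; _×_; _,_; proj₁; proj₂)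
open import Data.Rational as ℚ using (mkℚ; 0ℚ; 1ℚ; ½)
import Data.Rational.Properties as ℚ
open import Data.Rational.Unnormalised as ℚᵘ using (mkℚᵘ; *≤*)
import Data.Rational.Unnormalised.Properties as ℚᵘ
open import Data.Sum using (inj₁; inj₂)
open import Function using (_∘_; Inverse)
open import Relation.Binary using (Monotonic₁)
open import Relation.Binary.PropositionalEquality
open import Relation.Nullary using (¬_; Dec; yes; no; contradiction)
open import Relation.Nullary.Decidable using (decidable-stable)
open Representation using (partialMap; domain; map; ⟦_⟧)
open HasModulus using (nonDecreasing; modulus)

private
  variable
    a b c ℓ ℓ₁ ℓ₂ ℓ₃ : Level

-- Powers of two and distances in Cantor space.

-- Serves twice: to locate the first difference of two names, and to find the last scale at which
-- two points still have close names.
last-before-failure : {P : ℕ → Set ℓ} → (∀ n → Dec (P n)) → P 0 → ∀ N → ¬ P N →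
                      ∃[ n ] (n < N × P n × ¬ P (suc n))
last-before-failure P? P0 zero    ¬P0 = contradiction P0 ¬P0
last-before-failure P? P0 (suc N) ¬PN with P? N
... | yes PN = N , n<1+n N , PN , ¬PN
... | no ¬PN′ with last-before-failure P? P0 N ¬PN′
...   | n , n<N , Pn , ¬P1+n = n , m<n⇒m<1+n n<N , Pn , ¬P1+n

½^-pos : ∀ n → 0ℚ ℚ.< ½^ n
½^-pos zero    = ℚ.positive⁻¹ 1ℚ
½^-pos (suc n) = ℚ.*-monoʳ-<-pos ½ (½^-pos n)

½^-step : ∀ n → ½^ suc n ℚ.≤ ½^ n
½^-step n = subst (½^ suc n ℚ.≤_) (ℚ.*-identityˡ (½^ n))
  (ℚ.*-monoʳ-≤-nonNeg (½^ n) {{ℚ.nonNegative (ℚ.<⇒≤ (½^-pos n))}} (ℚ.≤ᵇ⇒≤ {½} {1ℚ} _))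

½^-anti : ∀ {m n} → m ≤ n → ½^ n ℚ.≤ ½^ m
½^-anti m≤n = anti (≤⇒≤′ m≤n)
  where
  anti : ∀ {m n} → m ≤′ n → ½^ n ℚ.≤ ½^ m
  anti ≤′-refl           = ℚ.≤-refl
  anti (≤′-step {n} m≤n) = ℚ.≤-trans (½^-step n) (anti m≤n)

2^--anti : ∀ {m n} → m ≤ n → 2^- n ≤ᴿ 2^- m
2^--anti m≤n = L⊆ λ q<½ⁿ → ℚ.<-≤-trans q<½ⁿ (½^-anti m≤n)

-- Unnormalised rationals express 1/(1+n) without a coprimality proof. The induction step reduces to
-- `2 + n ≤ 2 * (1 + n)`.
½^n≤1/[1+n] : ∀ n → ℚ.toℚᵘ (½^ n) ℚᵘ.≤ mkℚᵘ (ℤ.+ 1) n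
½^n≤1/[1+n] zero    = ℚᵘ.≤-refl
½^n≤1/[1+n] (suc n) = begin
  ℚ.toℚᵘ (½ ℚ.* ½^ n)              ≃⟨ ℚ.toℚᵘ-homo-* ½ (½^ n) ⟩
  ℚ.toℚᵘ ½ ℚᵘ.* ℚ.toℚᵘ (½^ n)      ≤⟨ ℚᵘ.*-monoʳ-≤-nonNeg (ℚ.toℚᵘ ½) (½^n≤1/[1+n] n) ⟩
  ℚ.toℚᵘ ½ ℚᵘ.* mkℚᵘ (ℤ.+ 1) n     ≤⟨ *≤* (ℤ.*-monoˡ-≤-nonNeg (ℤ.+ 1)
                                        (ℤ.+≤+ (s≤s (subst (suc n ≤_) (+-comm (suc n + 0) n)
                                          (≤-trans (m≤m+n (suc n) 0) (m≤m+n _ n)))))) ⟩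
  mkℚᵘ (ℤ.+ 1) (suc n)             ∎
  where open ℚᵘ.≤-Reasoning

archimedean : ∀ q → 0ℚ ℚ.< q → ∃[ n ] ½^ n ℚ.≤ q
-- The field `e` is the denominator minus one, so `q` is at least 1/(1+e) and the exponent `e`
-- suffices.
archimedean q@(mkℚ (ℤ.+ suc k) e _) _ = e , ℚ.toℚᵘ-cancel-≤
  (ℚᵘ.≤-trans (½^n≤1/[1+n] e)
    (*≤* (ℤ.*-monoʳ-≤-nonNeg (ℤ.+ suc e) (ℤ.+≤+ (s≤s (z≤n {k}))))))
archimedean (mkℚ (ℤ.+ zero) e _) (ℚ.*<* 0<0) = contradiction 0<0 (ℤ.<-irrefl (sym (ℤ.*-zeroˡ (ℤ.+ suc e))))
archimedean (mkℚ ℤ.-[1+ k ] e _) (ℚ.*<* ())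

≤2^-⇒≤0 : ∀ r → (∀ n → r ≤ᴿ 2^- n) → r ≤ᴿ 0ᴿ
≤2^-⇒≤0 r r≤ = L⊆ λ {q} q∈r → below q∈r (ℚ._<?_ q 0ℚ)
  where
  below : ∀ {q} → ℝ.L r q → Dec (q ℚ.< 0ℚ) → q ℚ.< 0ℚ
  below q∈r (yes q<0) = q<0
  -- Roundedness moves a nonnegative `q` in the cut up to a positive `q′`, which lies above some
  -- power of ½.
  below q∈r (no q≮0) =
    let (q′ , q<q′ , q′∈r) = ℝ.rounded r q∈r
        (n , ½ⁿ≤q′)        = archimedean q′ (ℚ.≤-<-trans (ℚ.≮⇒≥ q≮0) q<q′)
    in contradiction (ℚ.<-≤-trans (L-⊆ (r≤ n) q′∈r) ½ⁿ≤q′) (ℚ.<-irrefl refl)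

Agree : ℕ → 𝒞 → 𝒞 → Set
Agree n u v = ∀ k → k < n → u k ≡ v k

agree⇒D≤ : ∀ n {u v} → Agree n u v → D u v ≤ᴿ 2^- n
agree⇒D≤ n agree = L⊆ λ where
  (inj₁ q<0) → ℚ.<-trans q<0 (½^-pos n)
  (inj₂ (m , (um≢vm , _) , q<½ᵐ)) →
    ℚ.<-≤-trans q<½ᵐ (½^-anti (≮⇒≥ λ m<n → um≢vm (agree m m<n)))

-- No distance lies strictly between two consecutive powers of two: names that do not agree on
-- `suc n` bits have their first difference at some `m ≤ n`.
¬D≤⇒D≥ : ExcludedMiddle 0ℓ → ∀ n {u v} → ¬ D u v ≤ᴿ 2^- suc n → 2^- n ≤ᴿ D u v
¬D≤⇒D≥ em n {u} {v} D≰ with last-before-failure {P = λ k → Agree k u v}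
  (λ _ → em) (λ _ ()) (suc n) (D≰ ∘ agree⇒D≤ (suc n))
... | m , s≤s m≤n , agree , ¬agree = L⊆ λ q<½ⁿ →
  inj₂ (m , ((λ um≡vm → ¬agree (extend um≡vm)) , agree) , ℚ.<-≤-trans q<½ⁿ (½^-anti m≤n))
  where
  extend : u m ≡ v m → Agree (suc m) u v
  extend um≡vm k (s≤s k≤m) with m≤n⇒m<n∨m≡n k≤m
  ... | inj₁ k<m  = agree k k<m
  ... | inj₂ refl = um≡vm

-- Elementary facts on metrics and moduli of continuity.

module _ (X : MetricSpace a ℓ) where
  open MetricSpace X using (_≈_; d; 0⇒≈; ≈⇒0; nonNegative) renaming (cong to d-cong)

  ≤0⇒≈ : ∀ {x y} → d x y ≤ᴿ 0ᴿ → x ≈ y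
  ≤0⇒≈ d≤0 = 0⇒≈ (d≤0 , nonNegative)

  ≈⇒≤0 : ∀ {x y} → x ≈ y → d x y ≤ᴿ 0ᴿ
  ≈⇒≤0 x≈y = proj₁ (≈⇒0 x≈y)

  d-resp-≤ : ∀ {x x′ y y′ r} → x ≈ x′ → y ≈ y′ → d x y ≤ᴿ r → d x′ y′ ≤ᴿ r
  d-resp-≤ x≈x′ y≈y′ = ≤ᴿ-trans (proj₂ (d-cong x≈x′ y≈y′))

module _ {X : MetricSpace a ℓ₁} {Y : MetricSpace b ℓ₂} where
  open Map using (to)

  weaken : {f : Map X Y} {μ ν : ℕ → ℕ} → HasModulus f μ → Monotonic₁ _≤_ _≤_ ν →
           (∀ n → μ n ≤ ν n) → HasModulus f ν
  weaken fμ ν-mono μ≤ν = record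
    { nonDecreasing = ν-mono
    ; modulus       = λ n x x′ d≤ → modulus fμ n x x′ (≤ᴿ-trans d≤ (2^--anti (μ≤ν n)))
    }

  modulus-≗ : {f : Map X Y} {μ ν : ℕ → ℕ} → HasModulus f μ → μ ≗ ν → HasModulus f ν
  modulus-≗ fμ μ≗ν = weaken fμ
    (λ {m} {n} m≤n → subst₂ _≤_ (μ≗ν m) (μ≗ν n) (nonDecreasing fμ m≤n))
    (λ n → ≤-reflexive (μ≗ν n))

  ∘-modulus : {Z : MetricSpace c ℓ₃} {g : Map Y Z} {f : Map X Y} {μ ν : ℕ → ℕ} →
              HasModulus g ν → HasModulus f μ → HasModulus (g ∘ᴹ f) (μ ∘ ν)
  ∘-modulus {f = f} {ν = ν} gν fμ = record
    { nonDecreasing = nonDecreasing fμ ∘ nonDecreasing gν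
    ; modulus       = λ n x x′ d≤ → modulus gν n (to f x) (to f x′) (modulus fμ (ν n) x x′ d≤)
    }

-- Covers and entropy.

module _ (X : MetricSpace a ℓ) where
  covered-mono : ∀ {m n N} → m ≤ n → CoveredBy X n N → CoveredBy X m N
  covered-mono m≤n (centre , cover) =
    centre , λ x → let (i , d≤) = cover x in i , ≤ᴿ-trans d≤ (2^--anti m≤n)

  entropy-mono : ∀ {η} → IsEntropy X η → Monotonic₁ _≤_ _≤_ η
  entropy-mono entropy {m} {n} m≤n with entropy m | entropy n
  ... | M , (_ , M-least) , ηm≡ | N , (cover , _) , ηn≡ =
    subst₂ _≤_ (sym ηm≡) (sym ηn≡) (⌈log₂⌉-mono-≤ (M-least N (covered-mono m≤n cover)))

  entropy≤ : ∀ {η} → IsEntropy X η → ∀ n m {N} → N ≤ 2 ^ m → CoveredBy X n N → η n ≤ m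
  entropy≤ entropy n m {N} N≤2^m cover with entropy n
  ... | M , (_ , M-least) , ηn≡ = subst₂ _≤_ (sym ηn≡) (⌈log₂2^n⌉≡n m)
    (⌈log₂⌉-mono-≤ (≤-trans (M-least N cover) N≤2^m))

-- Names of points: prefix covers and the induced distance.

module _ {X : MetricSpace a ℓ} where
  open MetricSpace X using (d; module EqC)

  module _ (em : ExcludedMiddle 0ℓ) (ξ : Representation X) where
    open Representation ξ using (dom; surjective)

    private
      -- A prefix as a function between finite sets, the form that `funToFin` numbers by
      -- `Fin (2 ^ m)`.
      bits : ∀ m → 𝒞 → Fin m → Fin 2
      bits m u k = Inverse.from Fin.2↔Bool (u (toℕ k))

      bits-agree : ∀ {m u v} → bits m u ≗ bits m v → Agree m u v
      bits-agree {m} {u} {v} eq k k<m =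
        subst (λ j → u j ≡ v j) (Fin.toℕ-fromℕ< k<m)
          (trans (sym (Inverse.strictlyInverseˡ Fin.2↔Bool _))
            (trans (cong (Inverse.to Fin.2↔Bool) (eq (fromℕ< k<m))) (Inverse.strictlyInverseˡ Fin.2↔Bool _)))

    prefix-cover : ∀ {μ} → HasModulus (map ξ) μ → ∀ n → ∃[ N ] (N ≤ 2 ^ μ n × CoveredBy X n N)
    prefix-cover {μ} ξμ n with em {∃ dom}
    ... | no ¬∃dom = 0 , z≤n , (λ ()) , λ x → contradiction (proj₁ (surjective x)) ¬∃dom
    ... | yes default = 2 ^ μ n , ≤-refl , (λ i → ⟦ ξ ⟧ (point i)) , covers
      where
      Prefix : Fin (2 ^ μ n) → ∃ dom → Set
      Prefix i (u , _) = bits (μ n) u ≗ finToFun i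

      choose : ∀ {i} → Dec (∃ (Prefix i)) → ∃ dom
      choose (yes (u , _)) = u
      -- A prefix that no name has still needs a centre; any point of the domain will do.
      choose (no _)        = default

      point : Fin (2 ^ μ n) → ∃ dom
      point i = choose {i} em

      choose-prefix : ∀ {i} (dec : Dec (∃ (Prefix i))) → ∃ (Prefix i) → Prefix i (choose dec)
      choose-prefix (yes (_ , prefix)) _ = prefix
      choose-prefix (no ¬∃)            ∃ = contradiction ∃ ¬∃

      covers : ∀ x → ∃[ i ] d (⟦ ξ ⟧ (point i)) x ≤ᴿ 2^- n
      covers x with surjective x
      -- The name `u` and the name chosen for its prefix `i` agree on `μ n` bits, so the modulus
      -- puts their images within 2^-n.
      ... | u , ξu≈x = i , d-resp-≤ X EqC.refl ξu≈x
        (modulus ξμ n (point i) u (agree⇒D≤ (μ n) (bits-agree λ k →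
          trans (choose-prefix em (u , prefix) k) (sym (prefix k)))))
        where
        i = funToFin (bits (μ n) (proj₁ u))
        prefix : Prefix i u
        prefix k = sym (Fin.finToFun-funToFin (bits (μ n) (proj₁ u)) k)

    entropy≤modulus : ∀ {η μ} → IsEntropy X η → HasModulus (map ξ) μ → ∀ n → η n ≤ μ n
    entropy≤modulus {μ = μ} entropy ξμ n =
      let (_ , N≤ , cover) = prefix-cover ξμ n in entropy≤ X entropy n (μ n) N≤ cover

    induced-distance : ∀ {μ} → HasModulus (map ξ) μ → ∀ x x′ →
                       ∃[ r ] IsInducedDistance (partialMap ξ) x x′ r
    -- This decides whether `x ≈ x′`, phrased by distances because `_≈_` may live in a level that
    -- `em` does not reach. If so, one name of both points attains the minimum 0.
    induced-distance {μ} ξμ x x′ with em {∀ n → d x x′ ≤ᴿ 2^- n}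
    induced-distance {μ} ξμ x x′ | yes d≤ with surjective x
    ... | u , ξu≈x = D (proj₁ u) (proj₁ u)
        , (u , u , ξu≈x , EqC.trans ξu≈x (≤0⇒≈ X (≤2^-⇒≤0 _ d≤)) , ≤ᴿ-refl , ≤ᴿ-refl)
        , λ (v , v′ , _ , _ , D≤s , _) → ≤ᴿ-trans
            (≤ᴿ-trans (≈⇒≤0 cantor λ _ → refl) (MetricSpace.nonNegative cantor {proj₁ v} {proj₁ v′})) D≤s
    induced-distance {μ} ξμ x x′ | no d≰ = dist
      where
      -- Stated with distances rather than _≈_, so that it lies in Set and
      -- excluded middle applies to it.
      Close : ℕ → Set
      Close n = ∃₂ λ (u u′ : ∃ dom) →
        d (⟦ ξ ⟧ u) x ≤ᴿ 0ᴿ × d (⟦ ξ ⟧ u′) x′ ≤ᴿ 0ᴿ × D (proj₁ u) (proj₁ u′) ≤ᴿ 2^- n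

      separated : ∃[ n ] ¬ d x x′ ≤ᴿ 2^- n
      separated with em {∃[ n ] ¬ d x x′ ≤ᴿ 2^- n}
      ... | yes sep = sep
      ... | no ¬sep = contradiction (λ n → decidable-stable em λ ¬d≤ → ¬sep (n , ¬d≤)) d≰

      close₀ : Close 0
      close₀ = let (u , ξu≈x) = surjective x ; (u′ , ξu′≈x′) = surjective x′ in
        u , u′ , ≈⇒≤0 X ξu≈x , ≈⇒≤0 X ξu′≈x′ , agree⇒D≤ 0 λ _ ()

      -- Names within 2^-μ(n) would put `x` and `x′` within 2^-n, so the search for close names
      -- stops at `μ n`.
      not-close : ¬ Close (μ (proj₁ separated))
      not-close (u , u′ , u≤ , u′≤ , D≤) = proj₂ separated
        (d-resp-≤ X (≤0⇒≈ X u≤) (≤0⇒≈ X u′≤) (modulus ξμ (proj₁ separated) u u′ D≤))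

      dist : ∃[ r ] IsInducedDistance (partialMap ξ) x x′ r
      dist with last-before-failure {P = Close} (λ _ → em) close₀ (μ (proj₁ separated)) not-close
      -- At the last close scale `n` the pair found is within 2^-n, while any pair of names, not
      -- being within 2^-(n+1), is at least 2^-n apart.
      ... | n , _ , (u , u′ , u≤ , u′≤ , D≤) , farther = D (proj₁ u) (proj₁ u′)
        , (u , u′ , ≤0⇒≈ X u≤ , ≤0⇒≈ X u′≤ , ≤ᴿ-refl , ≤ᴿ-refl)
        , λ (v , v′ , ξv≈x , ξv′≈x′ , D≤s , _) → ≤ᴿ-trans D≤
            (≤ᴿ-trans (¬D≤⇒D≥ em n λ D≤₁ → farther (v , v′ , ≈⇒≤0 X ξv≈x , ≈⇒≤0 X ξv′≈x′ , D≤₁)) D≤s)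

-- Arithmetic of polynomial and linear bounds.

-- The base is at least 2, so that constants and sums are absorbed by the exponent.
PolynomiallyBounded : (ℕ → ℕ) → Set
PolynomiallyBounded g = ∃[ k ] (∀ n → g n ≤ (2 + n) ^ k)

module PolynomiallyBounded where

  n<2^n : ∀ n → n < 2 ^ n
  n<2^n zero    = s≤s z≤n
  n<2^n (suc n) = subst (suc (suc n) ≤_) (cong (2 ^ n +_) (sym (+-identityʳ (2 ^ n))))
    (+-mono-≤ (≤-trans (s≤s z≤n) (n<2^n n)) (n<2^n n))

  const : ∀ c → PolynomiallyBounded (λ _ → c)
  const c = c , λ n → ≤-trans (<⇒≤ (n<2^n c)) (^-monoˡ-≤ c (m≤m+n 2 n))

  id : PolynomiallyBounded (λ n → n)
  id = 1 , λ n → subst (n ≤_) (sym (^-identityʳ (2 + n))) (m≤n+m n 2)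

  plus : ∀ {f g} → PolynomiallyBounded f → PolynomiallyBounded g →
         PolynomiallyBounded (λ n → f n + g n)
  plus {f} {g} (j , f≤) (k , g≤) = suc (j + k) , λ n → begin
    f n + g n                                       ≤⟨ +-mono-≤ (f≤ n) (g≤ n) ⟩
    (2 + n) ^ j + (2 + n) ^ k                       ≤⟨ +-mono-≤ (^-monoʳ-≤ (2 + n) (m≤m+n j k))
                                                                (^-monoʳ-≤ (2 + n) (m≤n+m k j)) ⟩
    -- With x for `(2 + n) ^ (j + k)`, the next line unfolds to x + (x + n * x).
    (2 + n) ^ (j + k) + (2 + n) ^ (j + k)           ≤⟨ +-monoʳ-≤ ((2 + n) ^ (j + k)) (m≤m+n _ (n * (2 + n) ^ (j + k))) ⟩
    (2 + n) ^ suc (j + k)                           ∎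
    where open ≤-Reasoning

  times : ∀ {f g} → PolynomiallyBounded f → PolynomiallyBounded g →
          PolynomiallyBounded (λ n → f n * g n)
  times {f} {g} (j , f≤) (k , g≤) = j + k , λ n →
    subst (f n * g n ≤_) (sym (^-distribˡ-+-* (2 + n) j k)) (*-mono-≤ (f≤ n) (g≤ n))

  compose : ∀ {f g} → PolynomiallyBounded f → PolynomiallyBounded g → PolynomiallyBounded (f ∘ g)
  -- The bound on `f (g n)` is a power of `2 + g n`, so it is `2 + g` that must be bounded.
  compose {f} {g} (j , f≤) g-bounded with plus (const 2) g-bounded
  ... | k , 2+g≤ = k * j , λ n → subst (f (g n) ≤_) (^-*-assoc (2 + n) k j)
    (≤-trans (f≤ (g n)) (^-monoˡ-≤ j (2+g≤ n)))

  power : ∀ c → PolynomiallyBounded (_^ c)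
  power zero    = const 1
  power (suc c) = times id (power c)

  polynomial-bound : ∀ c → PolynomiallyBounded (bound polynomial c)
  polynomial-bound c = plus (const c) (times (const c) (power c))

  polynomial-eval : ∀ p → PolynomiallyBounded (eval p)
  polynomial-eval []      = const 0
  polynomial-eval (c ∷ p) = plus (const c) (times id (polynomial-eval p))

  n≤3^n : ∀ n → n ≤ 3 ^ n
  n≤3^n n = ≤-trans (<⇒≤ (n<2^n n)) (^-monoˡ-≤ n (s≤s (s≤s z≤n)))

  -- The same number is constant term, coefficient and exponent of `bound polynomial`, and `3 ^ k`
  -- can be all three. At 0 the constant term exceeds `2 ^ k`; for positive n, `2 + n ≤ 3 * n`
  -- yields the coefficient, and `k ≤ 3 ^ k` raises the exponent.
  ≤bound : ∀ {g} → PolynomiallyBounded g → ∃[ c ] (∀ n → g n ≤ bound polynomial c n)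
  ≤bound {g} (k , g≤) = 3 ^ k , λ n → ≤-trans (g≤ n) (power≤ n)
    where
    open ≤-Reasoning
    power≤ : ∀ n → (2 + n) ^ k ≤ bound polynomial (3 ^ k) n
    power≤ zero      = ≤-trans (^-monoˡ-≤ k (s≤s (s≤s z≤n))) (m≤m+n _ _)
    power≤ n@(suc m) = begin
      (2 + n) ^ k                     ≤⟨ ^-monoˡ-≤ k 2+n≤3*n ⟩
      (3 * n) ^ k                     ≡⟨ ^-distribʳ-* k 3 n ⟩
      3 ^ k * n ^ k                   ≤⟨ *-monoʳ-≤ (3 ^ k) (^-monoʳ-≤ n (n≤3^n k)) ⟩
      3 ^ k * n ^ (3 ^ k)             ≤⟨ m≤n+m _ _ ⟩
      3 ^ k + 3 ^ k * n ^ (3 ^ k)     ∎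
      where
      2+n≤3*n : 2 + n ≤ 3 * n
      2+n≤3*n = begin
        2 + n           ≡⟨ +-comm 2 n ⟩
        n + 2           ≤⟨ +-monoʳ-≤ n (*-monoʳ-≤ 2 (s≤s (z≤n {m}))) ⟩
        n + 2 * n       ∎
      ^-distribʳ-* : ∀ k m n → (m * n) ^ k ≡ m ^ k * n ^ k
      ^-distribʳ-* zero    m n = refl
      ^-distribʳ-* (suc k) m n = trans (cong (m * n *_) (^-distribʳ-* k m n))
        ([m*n]*[o*p]≡[m*o]*[n*p] m n (m ^ k) (n ^ k))

boundPolynomial : ℕ → Polynomial
-- For `c` equal to 0 the constant and the leading term would share degree 0; the bound is then 0.
boundPolynomial zero    = []
boundPolynomial (suc c) = suc c ∷ replicate c 0 ++ (suc c ∷ [])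

bound≗eval : ∀ c → bound polynomial c ≗ eval (boundPolynomial c)
bound≗eval zero    n = refl
bound≗eval (suc c) n = cong (suc c +_) (sym (begin
  n * eval (replicate c 0 ++ (suc c ∷ [])) n  ≡⟨ cong (n *_) (monomial c) ⟩
  n * (n ^ c * suc c)                         ≡⟨ *-assoc n (n ^ c) (suc c) ⟨
  n ^ suc c * suc c                           ≡⟨ *-comm (n ^ suc c) (suc c) ⟩
  suc c * n ^ suc c                           ∎))
  where
  open ≡-Reasoning
  monomial : ∀ k {b} → eval (replicate k 0 ++ (b ∷ [])) n ≡ n ^ k * b
  monomial zero    {b} = cong (b +_) (*-zeroʳ n)
  monomial (suc k) {b} = trans (cong (n *_) (monomial k)) (sym (*-assoc n (n ^ k) b))

bound-hasGrowth : ∀ γ c → HasGrowth γ (bound γ c)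
bound-hasGrowth polynomial c = boundPolynomial c , bound≗eval c
bound-hasGrowth linear     c = c , λ _ → refl

growth≤bound : ∀ γ {g} → HasGrowth γ g → ∃[ c ] (∀ n → g n ≤ bound γ c n)
growth≤bound polynomial (p , g≗p) =
  let (c , p≤) = PolynomiallyBounded.≤bound (PolynomiallyBounded.polynomial-eval p)
  in c , λ n → ≤-trans (≤-reflexive (g≗p n)) (p≤ n)
growth≤bound linear     (c , g≗)  = c , λ n → ≤-reflexive (g≗ n)

bound-mono : ∀ γ c → Monotonic₁ _≤_ _≤_ (bound γ c)
bound-mono polynomial c m≤n = +-monoʳ-≤ c (*-monoʳ-≤ c (^-monoˡ-≤ c m≤n))
bound-mono linear     c m≤n = +-monoʳ-≤ c (*-monoʳ-≤ c m≤n)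

bound-∘ : ∀ γ c c′ → ∃[ c″ ] (∀ n → bound γ c (bound γ c′ n) ≤ bound γ c″ n)
bound-∘ polynomial c c′ = ≤bound (compose (polynomial-bound c) (polynomial-bound c′))
  where open PolynomiallyBounded
bound-∘ linear c c′ = c + c * c′ , λ n → begin
  c + c * (c′ + c′ * n)              ≡⟨ cong (c +_) (*-distribˡ-+ c c′ (c′ * n)) ⟩
  c + (c * c′ + c * (c′ * n))        ≡⟨ +-assoc c (c * c′) _ ⟨
  (c + c * c′) + c * (c′ * n)        ≡⟨ cong (c + c * c′ +_) (*-assoc c c′ n) ⟨
  (c + c * c′) + (c * c′) * n        ≤⟨ +-monoʳ-≤ (c + c * c′) (*-monoˡ-≤ n (m≤n+m (c * c′) c)) ⟩
  (c + c * c′) + (c + c * c′) * n    ∎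
  where open ≤-Reasoning

-- The linear statements about realizers ask for a single constant where the argument produces two.
linear-bounds-⊔ : ∀ {g} → Monotonic₁ _≤_ _≤_ g → ∀ c c′ n →
  bound linear c (g (bound linear c′ n)) ≤ bound linear (c ⊔ c′) (g (bound linear (c ⊔ c′) n))
linear-bounds-⊔ g-mono c c′ n = linear-mono (m≤m⊔n c c′) (g-mono (linear-mono (m≤n⊔m c c′) ≤-refl))
  where
  linear-mono : ∀ {c c′ n n′} → c ≤ c′ → n ≤ n′ → bound linear c n ≤ bound linear c′ n′
  linear-mono c≤c′ n≤n′ = +-mono-≤ c≤c′ (*-mono-≤ c≤c′ n≤n′)

polynomial-bounds≗evals : ∀ g c c′ →
  bound polynomial c ∘ g ∘ bound polynomial c′ ≗
  eval (boundPolynomial c) ∘ g ∘ eval (boundPolynomial c′)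
polynomial-bounds≗evals g c c′ n =
  trans (bound≗eval c _) (cong (eval (boundPolynomial c) ∘ g) (bound≗eval c′ n))

-- Reductions and the transfer of standardness.

module _ (γ : Growth) {X : MetricSpace a ℓ} where
  open MetricSpace X using (_≈_; d; module EqC)

  reduction-trans : {ξ₁ ξ₂ ξ₃ : PartialMap X} →
                    Reduction γ ξ₁ ξ₂ → Reduction γ ξ₂ ξ₃ → Reduction γ ξ₁ ξ₃
  reduction-trans R S = record
    { μ          = S.μ
    ; μ′         = R.μ′
    ; μ-minimal  = S.μ-minimal
    ; μ′-minimal = R.μ′-minimal
    ; G          = S.G ∘ᴹ R.G
    ; ν          = R.ν ∘ S.ν
    ; G-modulus  = ∘-modulus {g = S.G} S.G-modulus R.G-modulus
    ; commutes   = λ u → EqC.trans (R.commutes u) (S.commutes (Map.to R.G u))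
    ; efficient  = let (c , Rν≤) = R.efficient ; (c′ , Sν≤) = S.efficient
                       (c″ , ∘≤) = bound-∘ γ c c′ in
        c″ , λ n → begin
          R.ν (S.ν (S.μ n))                  ≤⟨ nonDecreasing R.G-modulus (Sν≤ n) ⟩
          -- Both `S.μ′` and `R.μ` are minimal moduli of the middle map, so minimality of the former
          -- bounds it by the latter.
          R.ν (S.μ′ (bound γ c′ n))          ≤⟨ nonDecreasing R.G-modulus
                                                  (proj₂ S.μ′-minimal R.μ (proj₁ R.μ-minimal) _) ⟩
          R.ν (R.μ (bound γ c′ n))           ≤⟨ Rν≤ _ ⟩
          R.μ′ (bound γ c (bound γ c′ n))    ≤⟨ nonDecreasing (proj₁ R.μ′-minimal) (∘≤ n) ⟩
          R.μ′ (bound γ c″ n)                ∎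
    }
    where
    open ≤-Reasoning
    module R = Reduction R
    module S = Reduction S

  Coherent : (ℕ → ℕ) → Representation X → Set _
  Coherent η ξ = ∃[ p ] (HasGrowth γ p × (∀ n x x′ → d x x′ ≤ᴿ 2^- p n →
    ∃[ r ] (IsInducedDistance (partialMap ξ) x x′ r × r ≤ᴿ 2^- η n)))

  -- The minimum in the coherence condition is attained, which supplies the names. Enlarging `p` to
  -- a `bound` only strengthens the assumption on `d x x′`.
  close-names : ∀ {η} {ξ : Representation X} → IsStandard γ X η ξ →
    ∃[ c ] (∀ n x x′ → d x x′ ≤ᴿ 2^- bound γ c n →
      ∃₂ λ u u′ → ⟦ ξ ⟧ u ≈ x × ⟦ ξ ⟧ u′ ≈ x′ × MetricSpace.d (domain ξ) u u′ ≤ᴿ 2^- η n)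
  close-names standard =
    let (p , growth , coherence) = IsStandard.coherent standard
        (c , p≤)                 = growth≤bound γ growth
    in c , λ n x x′ d≤ →
      let (r , ((u , u′ , ξu≈x , ξu′≈x′ , D≤r , _) , _) , r≤) =
            coherence n x x′ (≤ᴿ-trans d≤ (2^--anti (p≤ n)))
      in u , u′ , ξu≈x , ξu′≈x′ , ≤ᴿ-trans D≤r r≤

  module _ (em : ExcludedMiddle 0ℓ) {η : ℕ → ℕ} (entropy : IsEntropy X η)
           {ξ ξ′ : Representation X}
           (standard : IsStandard γ X η ξ) (admissible : IsAdmissible γ X η ξ′) where
    private
      module S = IsStandard standard
      module A = IsAdmissible admissible

      ξ→ξ′ : Reduction γ (partialMap ξ) (partialMap ξ′)
      ξ→ξ′ = A.universal ξ (S.μ , proj₁ S.μ-minimal)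

      module R = Reduction ξ→ξ′

      -- Tells how close names for `ξ` must be for the reduction to carry them within 2^-μ(n), on
      -- the scale of the entropy. Efficiency leads to the modulus of `ξ`, optimality of `ξ` from
      -- there to `η`.
      transfer : ∃[ c ] (∀ n → R.ν (R.μ n) ≤ η (bound γ c n))
      transfer =
        let (c , ν≤) = R.efficient ; (c′ , μ≤) = S.optimal ; (c″ , ∘≤) = bound-∘ γ c′ c
        in c″ , λ n → begin
          R.ν (R.μ n)                     ≤⟨ ν≤ n ⟩
          R.μ′ (bound γ c n)              ≤⟨ proj₂ R.μ′-minimal S.μ (proj₁ S.μ-minimal) _ ⟩
          S.μ (bound γ c n)               ≤⟨ μ≤ _ ⟩
          η (bound γ c′ (bound γ c n))    ≤⟨ entropy-mono X entropy (∘≤ n) ⟩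
          η (bound γ c″ n)                ∎
        where open ≤-Reasoning

      coherent′ : Coherent η ξ′
      coherent′ =
        let (c , names)  = close-names standard
            (c′ , ν≤)    = transfer
            (c″ , ∘≤)    = bound-∘ γ c c′
        in bound γ c″ , bound-hasGrowth γ c″ , λ n x x′ d≤ →
          let (u , u′ , ξu≈x , ξu′≈x′ , D≤) =
                -- At this level the names are within 2^-η(`bound γ c′ n`), hence within 2^-ν(μ(n))
                -- by `transfer`.
                names (bound γ c′ n) x x′ (≤ᴿ-trans d≤ (2^--anti (∘≤ n)))
              GD≤ = modulus R.G-modulus (R.μ n) u u′ (≤ᴿ-trans D≤ (2^--anti (ν≤ n)))
              (r , (attained , least)) = induced-distance em ξ′ (proj₁ A.μ-minimal) x x′
          in r , (attained , least)
            , ≤ᴿ-trans (least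
                ( Map.to R.G u , Map.to R.G u′
                , EqC.trans (EqC.sym (R.commutes u)) ξu≈x
                , EqC.trans (EqC.sym (R.commutes u′)) ξu′≈x′
                , ≤ᴿ-refl , ≤ᴿ-refl))
                -- The images are within 2^-μ(n) for the modulus of `ξ′`, and `η n` is at most that
                -- modulus by the prefix cover.
                (≤ᴿ-trans GD≤ (2^--anti (entropy≤modulus em ξ′ entropy (proj₁ R.μ-minimal) n)))

    admissible⇒standard : IsStandard γ X η ξ′
    admissible⇒standard = record
      { μ         = A.μ
      ; μ-minimal = A.μ-minimal
      ; optimal   = A.optimal
      -- Admissibility of `ξ′` concerns surjective maps only. An arbitrary `ξ″` is first reduced to
      -- `ξ`, which is surjective and so reduces to `ξ′`.
      ; universal = λ ξ″ modulus″ → reduction-trans (S.universal ξ″ modulus″) ξ→ξ′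
      ; coherent  = coherent′
      }

-- Moduli of maps and of their realizers.

module _ (γ : Growth) {X : MetricSpace a ℓ₁} {Y : MetricSpace b ℓ₂} {η : ℕ → ℕ}
         {ξ : Representation X} (ξ-standard : IsStandard γ X η ξ) (f : Map X Y) where

  descend-modulus : ∀ {lam} → Monotonic₁ _≤_ _≤_ lam → HasModulus (f ∘ᴹ map ξ) (η ∘ lam) →
                    ∃[ c ] HasModulus f (bound γ c ∘ lam)
  descend-modulus {lam} lam-mono fξ-modulus =
    let (c , names) = close-names γ ξ-standard
    in c , record
      { nonDecreasing = bound-mono γ c ∘ lam-mono
      ; modulus       = λ n x x′ d≤ →
          -- Level `lam n` makes the names 2^-η(`lam n`)-close, as the modulus of `f ∘ᴹ map ξ` at
          -- `n` demands.
          let (u , u′ , ξu≈x , ξu′≈x′ , D≤) = names (lam n) x x′ d≤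
          in d-resp-≤ Y (Map.to-cong f ξu≈x) (Map.to-cong f ξu′≈x′) (modulus fξ-modulus n u u′ D≤)
      }

  module _ {θ : ℕ → ℕ} {υ : Representation Y} (υ-standard : IsStandard γ Y θ υ)
           {lam : ℕ → ℕ} (lam-mono : Monotonic₁ _≤_ _≤_ lam) where
    private
      module S = IsStandard ξ-standard
      module T = IsStandard υ-standard

    -- The composite of `ξ` and `f` is a partial map into `Y`, possibly not surjective, and a
    -- reduction of it to `υ` is exactly a realizer. Its estimate starts from `θ` being at most the
    -- modulus of `υ` and ends with optimality of `ξ`.
    modulus⇒realizer : ExcludedMiddle 0ℓ → IsEntropy Y θ → HasModulus f lam →
      ∃[ F ] (IsRealizer (partialMap ξ) (partialMap υ) f F ×
        ∃[ Λ ] (HasModulus F Λ × ∃₂ λ c c′ → ∀ n → Λ (θ n) ≤ η (bound γ c (lam (bound γ c′ n)))))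
    modulus⇒realizer em θ-entropy f-modulus =
      let (c , μ≤) = S.optimal ; (c′ , ν≤) = R.efficient
      in R.G , R.commutes , R.ν , R.G-modulus , c , c′ , λ n → begin
        R.ν (θ n)                          ≤⟨ nonDecreasing R.G-modulus
                                                (entropy≤modulus em υ θ-entropy (proj₁ R.μ-minimal) n) ⟩
        R.ν (R.μ n)                        ≤⟨ ν≤ n ⟩
        R.μ′ (bound γ c′ n)                ≤⟨ proj₂ R.μ′-minimal (S.μ ∘ lam) fξ-modulus _ ⟩
        S.μ (lam (bound γ c′ n))           ≤⟨ μ≤ _ ⟩
        η (bound γ c (lam (bound γ c′ n))) ∎
      where
      open ≤-Reasoning

      fξ : PartialMap Y
      fξ = record
        { dom      = Representation.dom ξ
        ; dom-resp = Representation.dom-resp ξ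
        ; map      = f ∘ᴹ map ξ
        }

      fξ-modulus : HasModulus (f ∘ᴹ map ξ) (S.μ ∘ lam)
      fξ-modulus = ∘-modulus {g = f} f-modulus (proj₁ S.μ-minimal)

      module R = Reduction (T.universal fξ (S.μ ∘ lam , fξ-modulus))

    -- The composite of `F` and `υ` is `f ∘ᴹ map ξ` up to `_≈_`. Optimality of `υ` bounds its
    -- modulus by `θ ∘ bound γ c′`, so the composite has modulus `η ∘ lam ∘ θ ∘ bound γ c′`, which
    -- descends to `f`.
    realizer⇒modulus : Monotonic₁ _≤_ _≤_ η → Monotonic₁ _≤_ _≤_ θ →
      (F : Map (domain ξ) (domain υ)) → IsRealizer (partialMap ξ) (partialMap υ) f F →
      HasModulus F (η ∘ lam) → ∃₂ λ c c′ → HasModulus f (bound γ c ∘ lam ∘ θ ∘ bound γ c′)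
    realizer⇒modulus η-mono θ-mono F realizes F-modulus =
      let (c′ , μ≤) = T.optimal
          mono : Monotonic₁ _≤_ _≤_ (lam ∘ θ ∘ bound γ c′)
          mono      = lam-mono ∘ θ-mono ∘ bound-mono γ c′
          (c , f-modulus) = descend-modulus {lam ∘ θ ∘ bound γ c′} mono record
            { nonDecreasing = η-mono ∘ mono
            ; modulus       = λ n u u′ D≤ →
                d-resp-≤ Y (EqC.sym (realizes u)) (EqC.sym (realizes u′))
                  (modulus (proj₁ T.μ-minimal) n (Map.to F u) (Map.to F u′)
                    (≤ᴿ-trans (modulus F-modulus (θ (bound γ c′ n)) u u′ D≤) (2^--anti (μ≤ n))))
            }
      in c , c′ , f-modulus
      where open MetricSpace Y using (module EqC)

theorem17 : ∀ {a ℓ₁ b ℓ₂} → ExcludedMiddle 0ℓ →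
  -- (a i)
  ((X : MetricSpace a ℓ₁) (η : ℕ → ℕ) → IsEntropy X η →
    (ξ ξ′ : Representation X) →
    IsStandard polynomial X η ξ → IsAdmissible polynomial X η ξ′ →
    IsStandard polynomial X η ξ′)
  ×
  -- (a ii)
  ((X : MetricSpace a ℓ₁) (η : ℕ → ℕ) → IsEntropy X η →
    (ξ ξ′ : Representation X) →
    IsStandard linear X η ξ → IsAdmissible linear X η ξ′ →
    IsStandard linear X η ξ′)
  ×
  -- (b i)
  ((X : MetricSpace a ℓ₁) (η : ℕ → ℕ) → IsEntropy X η →
    (Y : MetricSpace b ℓ₂) (ξ : Representation X) (f : Map X Y)
    (lam : ℕ → ℕ) → Monotonic₁ _≤_ _≤_ lam →
    HasModulus (f ∘ᴹ map ξ) (η ∘ lam) →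
    IsStandard polynomial X η ξ →
    ∃[ c ] HasModulus f (λ n → c + c * lam n ^ c))
  ×
  -- (b ii)
  ((X : MetricSpace a ℓ₁) (η : ℕ → ℕ) → IsEntropy X η →
    (Y : MetricSpace b ℓ₂) (ξ : Representation X) (f : Map X Y)
    (lam : ℕ → ℕ) → Monotonic₁ _≤_ _≤_ lam →
    HasModulus (f ∘ᴹ map ξ) (η ∘ lam) →
    IsStandard linear X η ξ →
    ∃[ c ] HasModulus f (λ n → c + c * lam n))
  ×
  -- (c i)
  ((X : MetricSpace a ℓ₁) (η : ℕ → ℕ) → IsEntropy X η →
    (Y : MetricSpace b ℓ₂) (θ : ℕ → ℕ) → IsEntropy Y θ →
    (ξ : Representation X) (υ : Representation Y)
    (lam : ℕ → ℕ) → Monotonic₁ _≤_ _≤_ lam →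
    IsStandard polynomial X η ξ → IsStandard polynomial Y θ υ →
    (f : Map X Y) → HasModulus f lam →
    ∃[ F ] (IsRealizer (partialMap ξ) (partialMap υ) f F ×
      ∃[ Λ ] (HasModulus F Λ ×
        ∃[ p ] ∃[ q ] (∀ n → Λ (θ n) ≤ η (eval p (lam (eval q n)))))))
  ×
  -- (c ii)
  ((X : MetricSpace a ℓ₁) (η : ℕ → ℕ) → IsEntropy X η →
    (Y : MetricSpace b ℓ₂) (θ : ℕ → ℕ) → IsEntropy Y θ →
    (ξ : Representation X) (υ : Representation Y)
    (lam : ℕ → ℕ) → Monotonic₁ _≤_ _≤_ lam →
    IsStandard linear X η ξ → IsStandard linear Y θ υ →
    (f : Map X Y) → HasModulus f lam →
    ∃[ F ] (IsRealizer (partialMap ξ) (partialMap υ) f F ×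
      ∃[ Λ ] (HasModulus F Λ ×
        ∃[ c ] (∀ n → Λ (θ n) ≤ η (c + c * lam (c + c * n))))))
  ×
  -- (d i)
  ((X : MetricSpace a ℓ₁) (η : ℕ → ℕ) → IsEntropy X η →
    (Y : MetricSpace b ℓ₂) (θ : ℕ → ℕ) → IsEntropy Y θ →
    (ξ : Representation X) (υ : Representation Y)
    (lam : ℕ → ℕ) → Monotonic₁ _≤_ _≤_ lam →
    IsStandard polynomial X η ξ → IsStandard polynomial Y θ υ →
    (f : Map X Y) (F : Map (domain ξ) (domain υ)) →
    IsRealizer (partialMap ξ) (partialMap υ) f F → HasModulus F (η ∘ lam) →
    ∃[ p ] ∃[ q ] HasModulus f (eval p ∘ lam ∘ θ ∘ eval q))
  ×
  -- (d ii)
  ((X : MetricSpace a ℓ₁) (η : ℕ → ℕ) → IsEntropy X η →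
    (Y : MetricSpace b ℓ₂) (θ : ℕ → ℕ) → IsEntropy Y θ →
    (ξ : Representation X) (υ : Representation Y)
    (lam : ℕ → ℕ) → Monotonic₁ _≤_ _≤_ lam →
    IsStandard linear X η ξ → IsStandard linear Y θ υ →
    (f : Map X Y) (F : Map (domain ξ) (domain υ)) →
    IsRealizer (partialMap ξ) (partialMap υ) f F → HasModulus F (η ∘ lam) →
    ∃[ c ] HasModulus f (λ n → c + c * lam (θ (c + c * n))))
theorem17 em =
    (λ X η η-entropy ξ ξ′ → admissible⇒standard polynomial em η-entropy)
  , (λ X η η-entropy ξ ξ′ → admissible⇒standard linear em η-entropy)
  , (λ X η η-entropy Y ξ f lam lam-mono fξ-modulus ξ-standard →
      descend-modulus polynomial ξ-standard f lam-mono fξ-modulus)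
  , (λ X η η-entropy Y ξ f lam lam-mono fξ-modulus ξ-standard →
      descend-modulus linear ξ-standard f lam-mono fξ-modulus)
  , (λ X η η-entropy Y θ θ-entropy ξ υ lam lam-mono ξ-standard υ-standard f f-modulus →
      let (F , realizes , Λ , F-modulus , c , c′ , Λ≤) =
            modulus⇒realizer polynomial ξ-standard f υ-standard lam-mono em θ-entropy f-modulus
      in F , realizes , Λ , F-modulus , boundPolynomial c , boundPolynomial c′ , λ n →
        subst (λ k → Λ (θ n) ≤ η k) (polynomial-bounds≗evals lam c c′ n) (Λ≤ n))
  , (λ X η η-entropy Y θ θ-entropy ξ υ lam lam-mono ξ-standard υ-standard f f-modulus →
      let (F , realizes , Λ , F-modulus , c , c′ , Λ≤) =
            modulus⇒realizer linear ξ-standard f υ-standard lam-mono em θ-entropy f-modulus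
      -- The larger constant serves inside and outside `lam`; monotonicity of the entropy passes the
      -- enlarged argument through `η`.
      in F , realizes , Λ , F-modulus , c ⊔ c′ , λ n →
        ≤-trans (Λ≤ n) (entropy-mono X η-entropy (linear-bounds-⊔ lam-mono c c′ n)))
  , (λ X η η-entropy Y θ θ-entropy ξ υ lam lam-mono ξ-standard υ-standard f F realizes F-modulus →
      let (c , c′ , f-modulus) =
            realizer⇒modulus polynomial ξ-standard f υ-standard lam-mono
              (entropy-mono X η-entropy) (entropy-mono Y θ-entropy) F realizes F-modulus
      in boundPolynomial c , boundPolynomial c′
        , modulus-≗ f-modulus (polynomial-bounds≗evals (lam ∘ θ) c c′))
  , (λ X η η-entropy Y θ θ-entropy ξ υ lam lam-mono ξ-standard υ-standard f F realizes F-modulus →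
      let (c , c′ , f-modulus) =
            realizer⇒modulus linear ξ-standard f υ-standard lam-mono
              (entropy-mono X η-entropy) (entropy-mono Y θ-entropy) F realizes F-modulus
      in c ⊔ c′ , weaken f-modulus
        (λ m≤n → bound-mono linear (c ⊔ c′)
          (lam-mono (entropy-mono Y θ-entropy (bound-mono linear (c ⊔ c′) m≤n))))
        (linear-bounds-⊔ (λ m≤n → lam-mono (entropy-mono Y θ-entropy m≤n)) c c′))
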